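{- Let $\mathbb K$ be a field of characteristic $p>2$, $V_{\mathbb K}$ a vector space over $\mathbb K$, and let $L_1,\dots,L_n:\mathbb Z^n\to\mathrm{GL}(V_{\mathbb K})$ define a $p$-invariant discrete flat connection on $\mathbb Z^n\times V_{\mathbb K}\to\mathbb Z^n$, with $p$-curvature functions $C_l(k)=L_l(k+(p-1)f_l)\cdots L_l(k+f_l)L_l(k)$. Then for all $1\le l,m\le n$ and $k\in\mathbb Z^n$: $$C_l(k+f_m)L_m(k)=L_m(k)C_l(k),\qquad C_l(k)C_m(k)=C_m(k)C_l(k),\qquad C_l(k+pf_m)=C_l(k).$$
   Context: $f_1,\dots,f_n$ is the standard basis of $\mathbb Z^n$. The functions $L_1,\dots,L_n$ define a $p$-invariant discrete flat connection if $L_i(k+pf_j)=L_i(k)$ and $L_i(k+f_j)L_j(k)=L_j(k+f_i)L_i(k)$ for all $1\le i,j\le n$ and $k\in\mathbb Z^n$. -}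

module Defs where

open import Algebra.Apartness.Bundles using (HeytingField; HeytingCommutativeRing)
open import Algebra.Bundles using (CommutativeRing; Group)
import Algebra.Definitions.RawMonoid as RawMonoidDefs
open import Algebra.Module.Bundles using (Module)
import Algebra.Module.Morphism.Construct.Composition as Composition
import Algebra.Module.Morphism.Construct.Identity as Identity
open import Algebra.Module.Morphism.Structures using (IsModuleIsomorphism)
open import Data.Fin.Base using (Fin)
open import Data.Integer.Base as ℤ using (ℤ; +_; 0ℤ; 1ℤ)
open import Data.Nat.Base as ℕ using (ℕ; zero; suc)
open import Data.Product.Base using (_,_; proj₁; proj₂)
open import Data.Vec.Base using (Vec; zipWith; map; replicate; _[_]≔_)
open import Function.Base using (id; _∘_)
open import Level using (Level; _⊔_) renaming (suc to lsuc)

private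
  variable
    c ℓ₁ ℓ₂ v ℓv : Level

fieldRing : HeytingField c ℓ₁ ℓ₂ → CommutativeRing c ℓ₁
fieldRing K = HeytingCommutativeRing.commutativeRing (HeytingField.heytingCommutativeRing K)

VectorSpace : HeytingField c ℓ₁ ℓ₂ → (v ℓv : Level) → Set (c ⊔ ℓ₁ ⊔ lsuc (v ⊔ ℓv))
VectorSpace K v ℓv = Module (fieldRing K) v ℓv

-- Characteristic p ≠ 0: p is the least positive integer with p · 1 = 0.
record HasPositiveCharacteristic (K : HeytingField c ℓ₁ ℓ₂) (p : ℕ) : Set ℓ₁ where
  open CommutativeRing (fieldRing K)
  open RawMonoidDefs +-rawMonoid using (_×_)
  field
    positive : 0 ℕ.< p
    vanishes : p × 1# ≈ 0#
    least    : ∀ q → 0 ℕ.< q → q × 1# ≈ 0# → p ℕ.≤ q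

module _ {R : CommutativeRing c ℓ₁} (V : Module R v ℓv) where

  open Module V

  record Automorphism : Set (c ⊔ v ⊔ ℓv) where
    field
      ⟦_⟧                 : Carrierᴹ → Carrierᴹ
      isModuleIsomorphism : IsModuleIsomorphism rawModule rawModule ⟦_⟧
    open IsModuleIsomorphism isModuleIsomorphism public

  open Automorphism

  private
    inverse : Automorphism → Automorphism
    inverse A = record
      { ⟦_⟧ = g
      ; isModuleIsomorphism = record
        { isModuleMonomorphism = record
          { isModuleHomomorphism = record
            { isBimoduleHomomorphism = record
              { +ᴹ-isGroupHomomorphism = record
                { isMonoidHomomorphism = record
                  { isMagmaHomomorphism = record
                    { isRelHomomorphism = record { cong = g-cong }
                    ; homo = λ x y → injective A (≈ᴹ-trans (fg (x +ᴹ y))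
                        (≈ᴹ-sym (≈ᴹ-trans (+ᴹ-homo A (g x) (g y)) (+ᴹ-cong (fg x) (fg y)))))
                    }
                  ; ε-homo = injective A (≈ᴹ-trans (fg 0ᴹ) (≈ᴹ-sym (0ᴹ-homo A)))
                  }
                ; ⁻¹-homo = λ x → injective A (≈ᴹ-trans (fg (-ᴹ x))
                    (≈ᴹ-sym (≈ᴹ-trans (-ᴹ-homo A (g x)) (-ᴹ‿cong (fg x)))))
                }
              ; *ₗ-homo = λ r x → injective A (≈ᴹ-trans (fg (r *ₗ x))
                  (≈ᴹ-sym (≈ᴹ-trans (*ₗ-homo A r (g x)) (*ₗ-cong R.refl (fg x)))))
              ; *ᵣ-homo = λ r x → injective A (≈ᴹ-trans (fg (x *ᵣ r))
                  (≈ᴹ-sym (≈ᴹ-trans (*ᵣ-homo A r (g x)) (*ᵣ-cong (fg x) R.refl))))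
              }
            }
          ; injective = λ {x} {y} gx≈gy →
              ≈ᴹ-trans (≈ᴹ-sym (fg x)) (≈ᴹ-trans (⟦⟧-cong A gx≈gy) (fg y))
          }
        ; surjective = λ y → ⟦ A ⟧ y , λ z≈fy → injective A (≈ᴹ-trans (fg _) z≈fy)
        }
      }
      where
        module R = CommutativeRing R
        g : Carrierᴹ → Carrierᴹ
        g y = proj₁ (surjective A y)
        fg : ∀ y → ⟦ A ⟧ (g y) ≈ᴹ y
        fg y = proj₂ (surjective A y) ≈ᴹ-refl
        g-cong : ∀ {x y} → x ≈ᴹ y → g x ≈ᴹ g y
        g-cong {x} {y} x≈y = injective A (≈ᴹ-trans (fg x) (≈ᴹ-trans x≈y (≈ᴹ-sym (fg y))))

    inverseʳ : ∀ A x → ⟦ A ⟧ (⟦ inverse A ⟧ x) ≈ᴹ x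
    inverseʳ A x = proj₂ (surjective A x) ≈ᴹ-refl

  -- Equality is pointwise; A ∙ B is composition, B applied first.
  GL : Group (c ⊔ v ⊔ ℓv) (v ⊔ ℓv)
  GL = record
    { Carrier = Automorphism
    ; _≈_     = λ A B → ∀ x → ⟦ A ⟧ x ≈ᴹ ⟦ B ⟧ x
    ; _∙_     = λ A B → record
      { ⟦_⟧                 = ⟦ A ⟧ ∘ ⟦ B ⟧
      ; isModuleIsomorphism =
          Composition.isModuleIsomorphism ≈ᴹ-trans (isModuleIsomorphism B) (isModuleIsomorphism A)
      }
    ; ε       = record
      { ⟦_⟧                 = id
      ; isModuleIsomorphism = Identity.isModuleIsomorphism rawModule ≈ᴹ-refl
      }
    ; _⁻¹     = inverse
    ; isGroup = record
      { isMonoid = record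
        { isSemigroup = record
          { isMagma = record
            { isEquivalence = record
              { refl  = λ _ → ≈ᴹ-refl
              ; sym   = λ p x → ≈ᴹ-sym (p x)
              ; trans = λ p q x → ≈ᴹ-trans (p x) (q x)
              }
            ; ∙-cong = λ {A} {B} {C} {D} p q x → ≈ᴹ-trans (⟦⟧-cong A (q x)) (p (⟦ D ⟧ x))
            }
          ; assoc = λ _ _ _ _ → ≈ᴹ-refl
          }
        ; identity = (λ _ _ → ≈ᴹ-refl) , (λ _ _ → ≈ᴹ-refl)
        }
      ; inverse = (λ A x → injective A (inverseʳ A (⟦ A ⟧ x))) , inverseʳ
      ; ⁻¹-cong = λ {A} {B} p x → injective A
          (≈ᴹ-trans (inverseʳ A x) (≈ᴹ-sym (≈ᴹ-trans (p (⟦ inverse B ⟧ x)) (inverseʳ B x))))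
      }
    }

-- Vectors rather than functions Fin n → ℤ, so that any function on the lattice
-- automatically respects equality of lattice points.
Lattice : ℕ → Set
Lattice n = Vec ℤ n

infixl 6 _+ᴸ_
infixr 7 _·_

_+ᴸ_ : ∀ {n} → Lattice n → Lattice n → Lattice n
_+ᴸ_ = zipWith ℤ._+_

_·_ : ∀ {n} → ℕ → Lattice n → Lattice n
s · k = map ((+ s) ℤ.*_) k

f : ∀ {n} → Fin n → Lattice n
f j = replicate _ 0ℤ [ j ]≔ 1ℤ

module _ {R : CommutativeRing c ℓ₁} (V : Module R v ℓv) {n : ℕ} (p : ℕ)
         (L : Fin n → Lattice n → Group.Carrier (GL V)) where

  open Group (GL V)

  record IsInvariantDiscreteFlatConnection : Set (v ⊔ ℓv) where
    field
      invariant : ∀ i j k → L i (k +ᴸ p · f j) ≈ L i k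
      flat      : ∀ i j k → L i (k +ᴸ f j) ∙ L j k ≈ L j (k +ᴸ f i) ∙ L i k

  -- transport l s k = L_l(k + (s-1)f_l) ⋯ L_l(k + f_l) L_l(k)
  transport : Fin n → ℕ → Lattice n → Carrier
  transport l zero    k = ε
  transport l (suc s) k = L l (k +ᴸ s · f l) ∙ transport l s k

  pCurvature : Fin n → Lattice n → Carrier
  pCurvature l k = transport l p k

{-# OPTIONS --safe #-}
-- By flatness, L_m intertwines the product of s consecutive L_l's started at k + f_m with
-- the one started at k, up to replacing L_m(k) by L_m(k + s f_l). For s = p the
-- p-invariance removes the shift, so L_m intertwines C_l; iterating this p times in the
-- direction f_m and using that C_l is p-invariant gives the commutation of C_l and C_m.
module Submission where

open import Defs
open import Algebra.Apartness.Bundles using (HeytingField)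
open import Algebra.Bundles using (CommutativeRing; Group)
open import Algebra.Module.Bundles using (Module)
open import Data.Fin.Base using (Fin)
open import Data.Integer.Base using (+_)
import Data.Integer.Properties as ℤ
open import Data.Nat.Base using (ℕ; zero; suc; _<_)
open import Data.Product.Base using (_×_; _,_)
open import Data.Vec.Base using ([]; _∷_)
open import Data.Vec.Properties using (zipWith-assoc; zipWith-comm)
open import Level using (Level)
open import Relation.Binary.PropositionalEquality as ≡ using (_≡_; cong; cong₂)
import Relation.Binary.Reasoning.Setoid as SetoidReasoning

+ᴸ-assoc : ∀ {n} (x y z : Lattice n) → (x +ᴸ y) +ᴸ z ≡ x +ᴸ (y +ᴸ z)
+ᴸ-assoc = zipWith-assoc ℤ.+-assoc

+ᴸ-comm : ∀ {n} (x y : Lattice n) → x +ᴸ y ≡ y +ᴸ x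
+ᴸ-comm = zipWith-comm ℤ.+-comm

+ᴸ-swap : ∀ {n} (x y z : Lattice n) → (x +ᴸ y) +ᴸ z ≡ (x +ᴸ z) +ᴸ y
+ᴸ-swap x y z = begin
  (x +ᴸ y) +ᴸ z  ≡⟨ +ᴸ-assoc x y z ⟩
  x +ᴸ (y +ᴸ z)  ≡⟨ cong (x +ᴸ_) (+ᴸ-comm y z) ⟩
  x +ᴸ (z +ᴸ y)  ≡⟨ +ᴸ-assoc x z y ⟨
  (x +ᴸ z) +ᴸ y  ∎
  where open ≡.≡-Reasoning

+ᴸ-zero· : ∀ {n} (x y : Lattice n) → x +ᴸ 0 · y ≡ x
+ᴸ-zero· []      []      = ≡.refl
+ᴸ-zero· (a ∷ x) (b ∷ y) = cong₂ _∷_ (ℤ.+-identityʳ a) (+ᴸ-zero· x y)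

suc· : ∀ {n} s (y : Lattice n) → suc s · y ≡ s · y +ᴸ y
suc· s []      = ≡.refl
suc· s (b ∷ y) = cong₂ _∷_ (≡.trans (ℤ.suc-* (+ s) b) (ℤ.+-comm b _)) (suc· s y)

-- Exhibits the last of `suc s` steps as a single step from `x +ᴸ s · y`, where `flat` or a one-step
-- intertwining applies.
+ᴸ-suc· : ∀ {n} s (x y : Lattice n) → x +ᴸ suc s · y ≡ (x +ᴸ s · y) +ᴸ y
+ᴸ-suc· s x y = ≡.trans (cong (x +ᴸ_) (suc· s y)) (≡.sym (+ᴸ-assoc x (s · y) y))

module _ {c ℓ v ℓv : Level} {R : CommutativeRing c ℓ} (V : Module R v ℓv) {n : ℕ} (p : ℕ)
         (L : Fin n → Lattice n → Group.Carrier (GL V))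
         (isConnection : IsInvariantDiscreteFlatConnection V p L) where

  open Group (GL V)
  open IsInvariantDiscreteFlatConnection isConnection
  open SetoidReasoning setoid

  private
    T = transport V p L
    C = pCurvature V p L

  -- Here and below automorphisms are passed explicitly: `≈` unfolds to an equality of underlying
  -- maps, which does not determine them.
  at : (F : Lattice n → Carrier) {x y : Lattice n} → x ≡ y → F x ≈ F y
  at F {x} eq = reflexive {x = F x} (cong F eq)

  -- Two commuting squares with the common edge `y` are pasted; `x` and `z` are the remaining outer
  -- edges.
  intertwine-step : ∀ {a a′ b b′ x y z} →
    a ∙ y ≈ z ∙ a′ → b ∙ x ≈ y ∙ b′ → (a ∙ b) ∙ x ≈ z ∙ (a′ ∙ b′)
  intertwine-step {a} {a′} {b} {b′} {x} {y} {z} ay bx = begin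
    (a ∙ b) ∙ x    ≈⟨ assoc a b x ⟩
    a ∙ (b ∙ x)    ≈⟨ ∙-congˡ {a} {b ∙ x} {y ∙ b′} bx ⟩
    a ∙ (y ∙ b′)   ≈⟨ assoc a y b′ ⟨
    (a ∙ y) ∙ b′   ≈⟨ ∙-congʳ {b′} {a ∙ y} {z ∙ a′} ay ⟩
    (z ∙ a′) ∙ b′  ≈⟨ assoc z a′ b′ ⟩
    z ∙ (a′ ∙ b′)  ∎

  -- Induction on `s`: each step pastes the flatness square at `k +ᴸ s · f l` onto the strip built
  -- so far, along the edge `L m (k +ᴸ s · f l)`.
  transport-intertwines : ∀ l m s k →
    T l s (k +ᴸ f m) ∙ L m k ≈ L m (k +ᴸ s · f l) ∙ T l s k
  -- Composing with `ε` does not change the underlying map, so only the base point needs adjusting.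
  transport-intertwines l m zero    k = at (L m) (≡.sym (+ᴸ-zero· k (f l)))
  transport-intertwines l m (suc s) k =
    intertwine-step
      {L l (k +ᴸ f m +ᴸ s · f l)} {L l (k +ᴸ s · f l)} {T l s (k +ᴸ f m)} {T l s k}
      {L m k} {L m (k +ᴸ s · f l)} {L m (k +ᴸ suc s · f l)}
      flatAt (transport-intertwines l m s k)
    where
    k′ = k +ᴸ s · f l
    flatAt : L l (k +ᴸ f m +ᴸ s · f l) ∙ L m k′ ≈ L m (k +ᴸ suc s · f l) ∙ L l k′
    flatAt = begin
      L l (k +ᴸ f m +ᴸ s · f l) ∙ L m k′  ≈⟨ at (λ z → L l z ∙ L m k′) (+ᴸ-swap k (f m) (s · f l)) ⟩
      L l (k′ +ᴸ f m) ∙ L m k′            ≈⟨ flat l m k′ ⟩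
      L m (k′ +ᴸ f l) ∙ L l k′            ≈⟨ at (λ z → L m z ∙ L l k′) (+ᴸ-suc· s k (f l)) ⟨
      L m (k +ᴸ suc s · f l) ∙ L l k′     ∎

  -- Holds factor by factor, once the shift by `p · f m` is moved past `s · f l`.
  transport-invariant : ∀ l m s k → T l s (k +ᴸ p · f m) ≈ T l s k
  transport-invariant l m zero    k = refl {ε}
  transport-invariant l m (suc s) k =
    ∙-cong {L l (k +ᴸ p · f m +ᴸ s · f l)} {L l k′} {T l s (k +ᴸ p · f m)} {T l s k}
      (begin
        L l (k +ᴸ p · f m +ᴸ s · f l)  ≈⟨ at (L l) (+ᴸ-swap k (p · f m) (s · f l)) ⟩
        L l (k′ +ᴸ p · f m)            ≈⟨ invariant l m k′ ⟩
        L l k′                         ∎)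
      (transport-invariant l m s k)
    where k′ = k +ᴸ s · f l

  pCurvature-invariant : ∀ l m k → C l (k +ᴸ p · f m) ≈ C l k
  pCurvature-invariant l m k = transport-invariant l m p k

  pCurvature-intertwines : ∀ l m k → C l (k +ᴸ f m) ∙ L m k ≈ L m k ∙ C l k
  pCurvature-intertwines l m k = begin
    C l (k +ᴸ f m) ∙ L m k      ≈⟨ transport-intertwines l m p k ⟩
    L m (k +ᴸ p · f l) ∙ C l k  ≈⟨ ∙-congʳ {C l k} {L m (k +ᴸ p · f l)} {L m k} (invariant m l k) ⟩
    L m k ∙ C l k               ∎

  -- Now `C l` is the edge carried along the path in direction `f m`; the squares pasted are those
  -- of `pCurvature-intertwines`, read backwards.
  pCurvature-transport : ∀ l m s k → T m s k ∙ C l k ≈ C l (k +ᴸ s · f m) ∙ T m s k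
  pCurvature-transport l m zero    k = at (C l) (≡.sym (+ᴸ-zero· k (f m)))
  pCurvature-transport l m (suc s) k =
    intertwine-step
      {L m k′} {L m k′} {T m s k} {T m s k} {C l k} {C l k′} {C l (k +ᴸ suc s · f m)}
      (begin
        L m k′ ∙ C l k′                  ≈⟨ pCurvature-intertwines l m k′ ⟨
        C l (k′ +ᴸ f m) ∙ L m k′         ≈⟨ at (λ z → C l z ∙ L m k′) (+ᴸ-suc· s k (f m)) ⟨
        C l (k +ᴸ suc s · f m) ∙ L m k′  ∎)
      (pCurvature-transport l m s k)
    where k′ = k +ᴸ s · f m

  pCurvature-comm : ∀ l m k → C l k ∙ C m k ≈ C m k ∙ C l k
  pCurvature-comm l m k = begin
    -- Moving the base point of `C l` by a full period gives the right-hand side of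
    -- `pCurvature-transport` for `s = p`, where `T m p k` is `C m k`.
    C l k ∙ C m k               ≈⟨ ∙-congʳ {C m k} {C l (k +ᴸ p · f m)} {C l k} (pCurvature-invariant l m k) ⟨
    C l (k +ᴸ p · f m) ∙ C m k  ≈⟨ pCurvature-transport l m p k ⟨
    C m k ∙ C l k               ∎

lemma2p1 : ∀ {c ℓ₁ ℓ₂ v ℓv : Level} (K : HeytingField c ℓ₁ ℓ₂) (p : ℕ) →
    HasPositiveCharacteristic K p → 2 < p →
    (V : VectorSpace K v ℓv) (n : ℕ) (L : Fin n → Lattice n → Group.Carrier (GL V)) →
    IsInvariantDiscreteFlatConnection V p L →
    let open Group (GL V)
        C = pCurvature V p L
    in ∀ (l m : Fin n) (k : Lattice n) →
         (C l (k +ᴸ f m) ∙ L m k ≈ L m k ∙ C l k) ×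
         (C l k ∙ C m k ≈ C m k ∙ C l k) ×
         (C l (k +ᴸ p · f m) ≈ C l k)
lemma2p1 K p _ _ V n L isConnection l m k =
  pCurvature-intertwines V p L isConnection l m k ,
  pCurvature-comm V p L isConnection l m k ,
  pCurvature-invariant V p L isConnection l m k
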